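{- Let $3\le m\le n$ and let $c$ be an exact $(m+n+1)$-coloring of $[m]\times[n]$ with no rainbow solution to $x_1+x_2=x_3$. Suppose there is a jump from $\alpha\in D_a$ to $\beta\in D_b$, so that $\alpha+\delta=\beta$ for some $\delta=(d_1,d_2)\in D_t$. Then $c(\alpha)\in c(D_m)$ or $c(\beta)\in c(D_m)$ or $c(\alpha)=c(\beta)$.
   Context: $[m]\times[n]=\{(i,j)\in\mathbb{Z}^2:1\le i\le m,1\le j\le n\}$ with componentwise addition. An $r$-coloring is a map $c:[m]\times[n]\to\{1,\dots,r\}$, exact if surjective; a rainbow solution is a triple $\alpha,\beta,\gamma$ with $\alpha+\beta=\gamma$ and pairwise distinct colors. Diagonals: $D_k=\{(i,j)\in[m]\times[n]: m-k=i-j\}$; $D_m$ is the main diagonal; $c(X)=\{c(x):x\in X\}$. For $\alpha=(a_1,a_2)\in D_a$ and $\beta=(b_1,b_2)\in D_b$ with $a\ne b$, there is a jump from $\alpha$ to $\beta$ if $a_1<b_1$ and $a_2<b_2$ (equivalently $\alpha+\delta=\beta$ for some $\delta\in[m]\times[n]$). -}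

module Defs where

open import Data.Empty using (⊥)
open import Data.Nat using (ℕ; _+_; _≤_; _<_)
open import Data.Product using (_×_; _,_; Σ; ∃; ∃-syntax)
open import Relation.Binary.PropositionalEquality using (_≡_; _≢_)

-- Points of ℤ² with positive coordinates, represented as pairs of naturals.
Point : Set
Point = ℕ × ℕ

InGrid : ℕ → ℕ → Point → Set
InGrid m n (i , j) = (1 ≤ i × i ≤ m) × (1 ≤ j × j ≤ n)

_⊕_ : Point → Point → Point
(a₁ , a₂) ⊕ (b₁ , b₂) = (a₁ + b₁ , a₂ + b₂)

-- A coloring of [m] × [n]; values outside the grid are irrelevant.
Coloring : Set
Coloring = Point → ℕ

IsColoring : ℕ → ℕ → ℕ → Coloring → Set
IsColoring m n r c = ∀ x → InGrid m n x → 1 ≤ c x × c x ≤ r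

IsExactColoring : ℕ → ℕ → ℕ → Coloring → Set
IsExactColoring m n r c =
  IsColoring m n r c × (∀ k → 1 ≤ k → k ≤ r → ∃[ x ] (InGrid m n x × c x ≡ k))

RainbowSolution : ℕ → ℕ → Coloring → Point → Point → Point → Set
RainbowSolution m n c α β γ =
  InGrid m n α × InGrid m n β × InGrid m n γ × (α ⊕ β ≡ γ) ×
  (c α ≢ c β) × (c α ≢ c γ) × (c β ≢ c γ)

NoRainbow : ℕ → ℕ → Coloring → Set
NoRainbow m n c = ∀ α β γ → RainbowSolution m n c α β γ → ⊥

-- (i , j) ∈ D_k  iff  (i , j) ∈ [m] × [n] and m - k = i - j (over ℤ),
-- written in ℕ as m + j = k + i.
InDiag : ℕ → ℕ → ℕ → Point → Set
InDiag m n k (i , j) = InGrid m n (i , j) × m + j ≡ k + i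

ColorOnDiag : ℕ → ℕ → Coloring → ℕ → ℕ → Set
ColorOnDiag m n c k col = ∃[ x ] (InDiag m n k x × c x ≡ col)

Jump : ℕ → ℕ → ℕ → ℕ → Point → Point → Set
Jump m n a b (a₁ , a₂) (b₁ , b₂) =
  InDiag m n a (a₁ , a₂) × InDiag m n b (b₁ , b₂) × a ≢ b × a₁ < b₁ × a₂ < b₂

{-# OPTIONS --safe #-}

-- A rainbow-free coloring is never exact with m + n + 1 colors, so the hypotheses are contradictory.
-- Write d_k = (k , k). Two points of one diagonal differ by some d_j, so every other diagonal
-- carries at most one color missing from D_m; counting colors, if w bounds the number of diagonals
-- that contribute no color of their own, D_m has w + 3 colors. First occurrences of colors on D_m
-- are at least doubling, which gives first occurrences d_k (k ≥ 2) and d_K with K ≥ 2^(w+1) k.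
-- Take on each contributing diagonal the least point of its own color. Near D_m one of these lies
-- at height about K, while the height is 1 at the corner; as only w diagonals are skipped, two
-- neighbouring diagonals have points (x , y), (x , y - 1) with y > k. Reflecting in these two
-- points turns d_k into (k , k - 1) and d_{k-1} into (k - 1 , k) without changing the color.
-- The same on the other side of D_m turns d_k into (k - 1 , k), so d_k and d_{k-1} share a color.

module Submission where

open import Defs
open import Data.Empty using (⊥; ⊥-elim)
open import Data.Nat using (ℕ; zero; suc; _+_; _*_; _∸_; _^_; _≤_; _<_; z≤n; s≤s; _≟_; _≤?_)
open import Data.Nat.Properties
open import Data.Nat.Tactic.RingSolver using (solve-∀)
open import Data.Fin using (Fin; toℕ)
open import Data.Fin.Properties using (toℕ<n; toℕ-injective; injective⇒≤)
open import Data.List using (List; []; _∷_; _++_; length; lookup)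
open import Data.List.Properties using (length-++)
open import Data.List.Membership.Propositional using (_∈_)
open import Data.List.Membership.Propositional.Properties using (∈-++⁺ˡ; ∈-++⁺ʳ)
open import Data.List.Relation.Unary.Any using (here; there; index)
open import Data.List.Relation.Unary.Any.Properties using (lookup-index)
open import Data.Nat.Induction using (<-rec)
open import Data.Product using (_×_; _,_; ∃; proj₁; proj₂)
open import Data.Sum using (_⊎_; inj₁; inj₂; [_,_]′)
open import Function using (_∘_; case_of_)
open import Relation.Binary.Definitions using (tri<; tri≈; tri>)
open import Relation.Binary.PropositionalEquality using (_≡_; _≢_; refl; sym; trans; cong; cong₂; subst)
open import Relation.Nullary using (¬_; Dec; yes; no)
open import Relation.Nullary.Decidable using (_×-dec_; _⊎-dec_; map′)
open import Relation.Unary using (Decidable)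

-- Transposition, and rainbow-freeness as a choice between equal colours.

infix 9 _ᵀ

_ᵀ : Coloring → Coloring
(c ᵀ) x = c (proj₂ x , proj₁ x)

noRainbowᵀ : ∀ {m n c} → NoRainbow m n c → NoRainbow n m (c ᵀ)
noRainbowᵀ nr (a₁ , a₂) (b₁ , b₂) (g₁ , g₂) ((p , q) , (r , s) , (t , u) , e , h) =
  nr (a₂ , a₁) (b₂ , b₁) (g₂ , g₁)
    ((q , p) , (s , r) , (u , t) , cong₂ _,_ (cong proj₂ e) (cong proj₁ e) , h)

-- The sums enter as equations, so that the sum point can be written in the coordinates of whichever
-- diagonal it lies on.
sum-colours : ∀ {m n c} → NoRainbow m n c → ∀ {a₁ a₂ b₁ b₂ g₁ g₂} →
  1 ≤ a₁ → 1 ≤ a₂ → 1 ≤ b₁ → 1 ≤ b₂ → g₁ ≤ m → g₂ ≤ n → a₁ + b₁ ≡ g₁ → a₂ + b₂ ≡ g₂ →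
  c (a₁ , a₂) ≡ c (b₁ , b₂) ⊎ c (a₁ , a₂) ≡ c (g₁ , g₂) ⊎ c (b₁ , b₂) ≡ c (g₁ , g₂)
sum-colours {m} {n} {c} nr {a₁} {a₂} {b₁} {b₂} 1≤a₁ 1≤a₂ 1≤b₁ 1≤b₂ g₁≤m g₂≤n refl refl
  with c (a₁ , a₂) ≟ c (b₁ , b₂) | c (a₁ , a₂) ≟ c (a₁ + b₁ , a₂ + b₂) | c (b₁ , b₂) ≟ c (a₁ + b₁ , a₂ + b₂)
... | yes e | _ | _ = inj₁ e
... | no _ | yes e | _ = inj₂ (inj₁ e)
... | no _ | no _ | yes e = inj₂ (inj₂ e)
... | no p | no q | no r = ⊥-elim (nr _ _ _
  ( ((1≤a₁ , m+n≤o⇒m≤o a₁ g₁≤m) , (1≤a₂ , m+n≤o⇒m≤o a₂ g₂≤n))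
  , ((1≤b₁ , m+n≤o⇒n≤o a₁ g₁≤m) , (1≤b₂ , m+n≤o⇒n≤o a₂ g₂≤n))
  , ((≤-trans 1≤a₁ (m≤m+n a₁ b₁) , g₁≤m) , (≤-trans 1≤a₂ (m≤m+n a₂ b₂) , g₂≤n))
  , refl , p , q , r ))

<⇒∃+ : ∀ {x y} → x < y → ∃ λ d → 1 ≤ d × x + d ≡ y
<⇒∃+ {x} {y} x<y = y ∸ x , m<n⇒0<n∸m x<y , m+[n∸m]≡n (<⇒≤ x<y)

-- Counting hits and misses over intervals.

∑ : (ℕ → ℕ) → ℕ → ℕ → ℕ
∑ f v zero = 0
∑ f v (suc d) = f v + ∑ f (suc v) d

missed : ∀ {A B : Set} → A ⊎ B → ℕ
missed = [ (λ _ → 0) , (λ _ → 1) ]′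

hits misses : ∀ {A B : ℕ → Set} → (∀ u → A u ⊎ B u) → ℕ → ℕ
hits s u = [ (λ _ → 1) , (λ _ → 0) ]′ (s u)
misses s u = missed (s u)

module _ {A B : ℕ → Set} (s : ∀ u → A u ⊎ B u) where

  hits+misses : ∀ v d → ∑ (hits s) v d + ∑ (misses s) v d ≡ d
  hits+misses v zero = refl
  hits+misses v (suc d) with s v
  ... | inj₁ _ = cong suc (hits+misses (suc v) d)
  ... | inj₂ _ = trans (+-suc _ _) (cong suc (hits+misses (suc v) d))

  collect : (∀ {u} → A u → ℕ) → ℕ → ℕ → List ℕ
  collect f v zero = []
  collect f v (suc d) = [ (λ a → f a ∷_) , (λ _ xs → xs) ]′ (s v) (collect f (suc v) d)

  length-collect : ∀ (f : ∀ {u} → A u → ℕ) v d → length (collect f v d) ≡ ∑ (hits s) v d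
  length-collect f v zero = refl
  length-collect f v (suc d) with s v
  ... | inj₁ _ = cong suc (length-collect f (suc v) d)
  ... | inj₂ _ = length-collect f (suc v) d

  ∈-collect : ∀ (f : ∀ {u} → A u → ℕ) d {v u a} → v ≤ u → u < v + d → s u ≡ inj₁ a → f a ∈ collect f v d
  ∈-collect f zero {v} v≤u u< _ = ⊥-elim (<⇒≱ u< (≤-trans (≤-reflexive (+-identityʳ v)) v≤u))
  ∈-collect f (suc d) {v} {u} v≤u u< e with m≤n⇒m<n∨m≡n v≤u
  ... | inj₂ refl rewrite e = here refl
  ... | inj₁ v<u with s v | ∈-collect f d v<u (subst (u <_) (+-suc v d) u<) e
  ...   | inj₁ _ | i = there i
  ...   | inj₂ _ | i = i

∑-++ : ∀ f v d e → ∑ f v (d + e) ≡ ∑ f v d + ∑ f (v + d) e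
∑-++ f v zero e = cong (λ x → ∑ f x e) (sym (+-identityʳ v))
∑-++ f v (suc d) e rewrite +-suc v d =
  trans (cong (f v +_) (∑-++ f (suc v) d e)) (sym (+-assoc (f v) _ _))

∑-⊆ : ∀ f {v d w e} → v ≤ w → w + e ≤ v + d → ∑ f w e ≤ ∑ f v d
∑-⊆ f {v} {d} {e = e} v≤w w+e≤v+d with m≤n⇒∃[o]m+o≡n v≤w
... | x , refl with m≤n⇒∃[o]m+o≡n (+-cancelˡ-≤ v (x + e) d (≤-trans (≤-reflexive (sym (+-assoc v x e))) w+e≤v+d))
...   | y , refl = begin
  ∑ f (v + x) e                                   ≤⟨ m≤n+m _ (∑ f v x) ⟩
  ∑ f v x + ∑ f (v + x) e                         ≡⟨ ∑-++ f v x e ⟨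
  ∑ f v (x + e)                                   ≤⟨ m≤m+n _ (∑ f (v + (x + e)) y) ⟩
  ∑ f v (x + e) + ∑ f (v + (x + e)) y             ≡⟨ ∑-++ f v (x + e) y ⟨
  ∑ f v (x + e + y)                               ∎
  where open ≤-Reasoning

∑-+ : ∀ f g v d → ∑ (λ i → f i + g i) v d ≡ ∑ f v d + ∑ g v d
∑-+ f g v zero = refl
∑-+ f g v (suc d) = trans (cong (f v + g v +_) (∑-+ f g (suc v) d)) (eq (f v) (g v) (∑ f (suc v) d) (∑ g (suc v) d))
  where
  eq : ∀ a b x y → a + b + (x + y) ≡ a + x + (b + y)
  eq = solve-∀

module _ {A B C D : ℕ → Set} (s : ∀ u → A u ⊎ B u) (t : ∀ u → C u ⊎ D u) where

  bothMisses : ℕ → ℕ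
  bothMisses i = misses s i + misses t i

  -- An index `i` that fails is charged to a miss at `i`, in the first sum, or at `i + i`, in the
  -- second; within each sum different indices are charged to different places.
  doubleHit : ∀ d a →
    (∃ λ i → a ≤ i × i < a + d × (A i × C i) × (A (i + i) × C (i + i))) ⊎
    d ≤ ∑ bothMisses a d + ∑ bothMisses (a + a) (d + d)
  doubleHit zero a = inj₂ z≤n
  doubleHit (suc d) a with doubleHit d (suc a)
  ... | inj₁ (i , a<i , i< , h) = inj₁ (i , <⇒≤ a<i , subst (i <_) (sym (+-suc a d)) i< , h)
  ... | inj₂ many rewrite +-suc d d | +-suc a a = attempt
    where
    X = ∑ bothMisses (suc a) d
    Y = ∑ bothMisses (suc (suc (a + a))) (d + d)
    -- The odd place `a + a + 1` is the double of no index, so its misses are just dropped from the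
    -- estimate.
    Z = bothMisses (suc (a + a))

    more : ∀ p q → 1 ≤ p + q → suc d ≤ p + X + (q + (Z + Y))
    more p q 1≤ = ≤-trans (+-mono-≤ 1≤ many)
      (≤-trans (m≤m+n _ Z) (≤-reflexive (eq p q X Y Z)))
      where
      eq : ∀ p q x y z → p + q + (x + y) + z ≡ p + x + (q + (z + y))
      eq = solve-∀

    attempt : (∃ λ i → a ≤ i × i < a + suc d × (A i × C i) × (A (i + i) × C (i + i))) ⊎
      suc d ≤ bothMisses a + X + (bothMisses (a + a) + (Z + Y))
    attempt with s a | t a | s (a + a) | t (a + a)
    ... | inj₁ p | inj₁ q | inj₁ p′ | inj₁ q′ = inj₁ (a , ≤-refl , m<m+n a (s≤s z≤n) , (p , q) , (p′ , q′))
    ... | inj₂ _ | q      | p′      | q′      = inj₂ (more (1 + missed q) (missed p′ + missed q′) (s≤s z≤n))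
    ... | inj₁ _ | inj₂ _ | p′      | q′      = inj₂ (more 1 (missed p′ + missed q′) (s≤s z≤n))
    ... | inj₁ _ | inj₁ _ | inj₂ _  | q′      = inj₂ (more 0 (1 + missed q′) (s≤s z≤n))
    ... | inj₁ _ | inj₁ _ | inj₁ _  | inj₂ _  = inj₂ (more 0 1 (s≤s z≤n))

-- Pigeonhole and bounded search.

covering⇒≤length : ∀ r (xs : List ℕ) → (∀ k → 1 ≤ k → k ≤ r → k ∈ xs) → r ≤ length xs
covering⇒≤length r xs cover = injective⇒≤ {f = λ i → index (position i)} injective
  where
  position : (i : Fin r) → suc (toℕ i) ∈ xs
  position i = cover (suc (toℕ i)) (s≤s z≤n) (toℕ<n i)
  injective : ∀ {i j} → index (position i) ≡ index (position j) → i ≡ j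
  injective {i} {j} e = toℕ-injective (suc-injective
    (trans (lookup-index (position i)) (trans (cong (lookup xs) e) (sym (lookup-index (position j))))))

searchLeast : ∀ {P : ℕ → Set} → Decidable P → ∀ b →
  (∃ λ z → P z × (∀ {x} → x < z → ¬ P x)) ⊎ (∀ {x} → x < b → ¬ P x)
searchLeast P? zero = inj₂ λ ()
searchLeast P? (suc b) with searchLeast P? b
... | inj₁ found = inj₁ found
... | inj₂ none with P? b
...   | yes pb = inj₁ (b , pb , none)
...   | no ¬pb = inj₂ λ { (s≤s x≤b) px → case m≤n⇒m<n∨m≡n x≤b of λ where
          (inj₁ x<b) → none x<b px
          (inj₂ refl) → ¬pb px }

1+n≤2^n : ∀ n → suc n ≤ 2 ^ n
1+n≤2^n zero = ≤-refl
1+n≤2^n (suc n) = ≤-trans (s≤s (m≤n+m (suc n) n)) (≤-trans (≤-reflexive (eq n)) (*-monoʳ-≤ 2 (1+n≤2^n n)))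
  where
  eq : ∀ n → suc (n + suc n) ≡ 2 * suc n
  eq = solve-∀

-- Colours missing from the main diagonal.

-- A diagonal on one side of the main one is addressed by its distance u ≥ 1 from it: u stands
-- for D_{m - u}, whose points are (y + u , y). The other side is the same for the transposed
-- coloring, which is why the grid sides m, n and the length p of the main diagonal are separate.
module Diagonals (m n p : ℕ) (c : Coloring) where

  colour : ℕ → ℕ → ℕ
  colour u y = c (y + u , y)

  New : ℕ → Set
  New v = ∀ {k} → 1 ≤ k → k ≤ p → c (k , k) ≢ v

  Fresh : ℕ → ℕ → Set
  Fresh u y = InGrid m n (y + u , y) × New (colour u y)

  FreshColour : ℕ → ℕ → Set
  FreshColour u v = ∃ λ y → Fresh u y × colour u y ≡ v

  onMain? : ∀ v → (∃ λ k → k < suc p × 1 ≤ k × c (k , k) ≡ v) ⊎ New v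
  onMain? v with anyUpTo? (λ k → (1 ≤? k) ×-dec (c (k , k) ≟ v)) (suc p)
  ... | yes found = inj₁ found
  ... | no none = inj₂ λ 1≤k k≤p e → none (_ , s≤s k≤p , 1≤k , e)

  fresh? : ∀ u → Decidable (Fresh u)
  fresh? u y = (((1 ≤? y + u) ×-dec (y + u ≤? m)) ×-dec ((1 ≤? y) ×-dec (y ≤? n))) ×-dec new?
    where
    new? : Dec (New (colour u y))
    new? with onMain? (colour u y)
    ... | inj₁ (k , s≤s k≤p , 1≤k , e) = no λ new → new 1≤k k≤p e
    ... | inj₂ new = yes new

  freshColour? : ∀ u → Decidable (FreshColour u)
  freshColour? u v = map′ (λ (y , _ , h) → y , h) (λ (y , h) → y , s≤s (proj₂ (proj₂ (proj₁ (proj₁ h)))) , h)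
    (anyUpTo? (λ y → fresh? u y ×-dec (colour u y ≟ v)) (suc n))

  Least : ℕ → ℕ → Set
  Least u y = Fresh u y × (∀ {z} → z < y → ¬ Fresh u z)

-- `diag≤p` makes `p` at least the shorter side without naming that side, so the transposed coloring
-- can use the same `p`.
module Uniqueness (m n p : ℕ) (diag≤p : ∀ {y} → y ≤ m → y ≤ n → y ≤ p)
                  (c : Coloring) (nr : NoRainbow m n c) where

  open Diagonals m n p c

  fresh-unique : ∀ {u y z} → Fresh u y → Fresh u z → y < z → colour u y ≡ colour u z
  fresh-unique {u} {y} {z} (((1≤yu , _) , (1≤y , _)) , newy) (((_ , zu≤) , (_ , z≤)) , newz) y<z
    with <⇒∃+ y<z
  ... | j , 1≤j , refl = case sum-colours nr 1≤yu 1≤y 1≤j 1≤j zu≤ z≤ (eq y u j) refl of λ where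
      (inj₁ e) → ⊥-elim (newy 1≤j j≤p (sym e))
      (inj₂ (inj₁ e)) → e
      (inj₂ (inj₂ e)) → ⊥-elim (newz 1≤j j≤p e)
    where
    eq : ∀ y u j → y + u + j ≡ y + j + u
    eq = solve-∀
    j≤p : j ≤ p
    j≤p = ≤-trans (m≤n+m j y) (diag≤p (m+n≤o⇒m≤o (y + j) zu≤) z≤)

  fresh-colour : ∀ {u y z} → Fresh u y → Fresh u z → colour u y ≡ colour u z
  fresh-colour {u} {y} {z} fy fz with <-cmp y z
  ... | tri< y<z _ _ = fresh-unique fy fz y<z
  ... | tri≈ _ refl _ = refl
  ... | tri> _ _ z<y = sym (fresh-unique fz fy z<y)

  new≢ : ∀ {u y j} → Fresh u y → 1 ≤ j → j ≤ y → c (j , j) ≢ colour u y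
  new≢ {u} {y} (((_ , yu≤) , (_ , y≤)) , new) 1≤j j≤y =
    new 1≤j (≤-trans j≤y (diag≤p (m+n≤o⇒m≤o y yu≤) y≤))

-- Representatives of the contributing diagonals, and reflection in them.

module Half (m n p : ℕ) (p≤m : p ≤ m) (p≤n : p ≤ n) (diag≤p : ∀ {y} → y ≤ m → y ≤ n → y ≤ p)
            (c : Coloring) (nr : NoRainbow m n c) where

  open Diagonals m n p c public
  open Diagonals n m p (c ᵀ) public using ()
    renaming (Fresh to Freshᵀ; FreshColour to FreshColourᵀ; freshColour? to freshColourᵀ?; colour to colourᵀ)
  open Uniqueness m n p diag≤p c nr public
  open Uniqueness n m p (λ q r → diag≤p r q) (c ᵀ) (noRainbowᵀ nr) public using ()
    renaming (fresh-colour to fresh-colourᵀ)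

  Seen : ℕ → ℕ → Set
  Seen u v = FreshColour u v ⊎ FreshColourᵀ u v

  -- A colour missing from the main diagonal is credited to the smallest distance at which it occurs
  -- on either side. A tie between the two sides at one distance is left open here.
  Rep : ℕ → ℕ → Set
  Rep u y = Least u y × (∀ {v} → v < u → ¬ Seen v (colour u y))

  Repeated : ℕ → Set
  Repeated u = ∀ {y} → Fresh u y → ∃ λ v → v < u × Seen v (colour u y)

  abstract
    status : ∀ u → ∃ (Rep u) ⊎ Repeated u
    status u with searchLeast (fresh? u) (suc n)
    ... | inj₂ none = inj₂ λ f → ⊥-elim (none (s≤s (proj₂ (proj₂ (proj₁ f)))) f)
    ... | inj₁ (y , fy , least)
      with anyUpTo? (λ v → freshColour? v (colour u y) ⊎-dec freshColourᵀ? v (colour u y)) u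
    ...   | yes (v , v<u , seen) = inj₂ λ f → v , v<u , subst (Seen v) (fresh-colour fy f) seen
    ...   | no unseen = inj₁ (y , (fy , least) , λ v<u seen → unseen (_ , v<u , seen))

  -- The fresh points of one diagonal share a single colour, so what the representative avoids, the
  -- whole diagonal avoids.
  rep-excludes : ∀ {u v y x} → Rep v y → u < v → Seen u x → ¬ FreshColour v x
  rep-excludes ((fy , _) , unseen) u<v seen (z , fz , refl) =
    unseen u<v (subst (Seen _) (fresh-colour fz fy) seen)

  -- Adding `d_j` leads to the least fresh point. Its colour cannot occur lower on the diagonal, by
  -- minimality, nor at `d_j`, so the two summands must agree.
  below-least : ∀ {u y z j} → Least u y → 1 ≤ z → 1 ≤ j → z + j ≡ y → colour u z ≡ c (j , j)
  below-least {u} {y} {z} {j} (fr@(((_ , yu≤) , (_ , y≤)) , new) , least) 1≤z 1≤j refl =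
    case sum-colours nr (≤-trans 1≤z (m≤m+n z u)) 1≤z 1≤j 1≤j yu≤ y≤ (eq z u j) refl of λ where
      (inj₁ e) → e
      (inj₂ (inj₁ e)) → ⊥-elim (least (m<m+n z 1≤j)
        ( ( (≤-trans 1≤z (m≤m+n z u) , ≤-trans (+-monoˡ-≤ u (m≤m+n z j)) yu≤)
          , (1≤z , ≤-trans (m≤m+n z j) y≤) )
        , subst New (sym e) new ))
      (inj₂ (inj₂ e)) → ⊥-elim (new≢ fr 1≤j (m≤n+m j z) e)
    where
    eq : ∀ z u j → z + u + j ≡ z + j + u
    eq = solve-∀

  -- Both representatives have first coordinate `y + 1 + u`. Subtracting the point of height
  -- `z = y - k` on one diagonal from the representative of the other leaves `(k + 1 , k)` or
  -- `(k , k + 1)`, and `below-least` colours the subtracted point like `d_(k+1)` or `d_k`.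
  -- Otherwise a representative's colour would occur at distance 1: `Rep (suc u)` forbids this on
  -- the same side, and `¬opp` on the other.
  descent-colours : ∀ {u y k} → 1 ≤ u → Rep u (suc y) → Rep (suc u) y →
    ¬ FreshColourᵀ 1 (colour u (suc y)) → 1 ≤ k → suc k ≤ y →
    c (suc k , k) ≡ c (suc k , suc k) × c (k , suc k) ≡ c (k , k)
  descent-colours {u} {y} {k} 1≤u (lst , _) (lst′ , seen′) ¬opp 1≤k k<y with <⇒∃+ k<y
  ... | z , 1≤z , refl = right , left
    where
    fr = proj₁ lst
    fr′ = proj₁ lst′
    bound = proj₁ fr
    bound′ = proj₁ fr′

    e₁ : ∀ z k → z + suc k ≡ suc (k + z)
    e₁ = solve-∀
    e₂ : ∀ z u k → z + u + suc k ≡ k + z + suc u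
    e₂ = solve-∀
    e₃ : ∀ z u k → z + suc u + k ≡ suc (k + z) + u
    e₃ = solve-∀

    k+z≤p : k + z ≤ p
    k+z≤p = diag≤p (m+n≤o⇒m≤o (k + z) (proj₂ (proj₁ bound′))) (proj₂ (proj₂ bound′))

    1+k≤m : suc k ≤ m
    1+k≤m = ≤-trans k<y (≤-trans k+z≤p p≤m)

    1+k≤n : suc k ≤ n
    1+k≤n = ≤-trans k<y (≤-trans k+z≤p p≤n)

    right : c (suc k , k) ≡ c (suc k , suc k)
    right =
      case sum-colours nr {z + u} {z} {suc k} {k} (≤-trans 1≤z (m≤m+n z u)) 1≤z (s≤s z≤n) 1≤k
             (proj₂ (proj₁ bound′)) (proj₂ (proj₂ bound′)) (e₂ z u k) (+-comm z k) of λ where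
        (inj₁ e) → trans (sym e) ez
        (inj₂ (inj₁ e)) → ⊥-elim (new≢ fr′ (s≤s z≤n) k<y (trans (sym ez) e))
        (inj₂ (inj₂ e)) → ⊥-elim (seen′ (s≤s 1≤u) (inj₁ (k ,
          (( (≤-trans 1≤k (m≤m+n k 1) , subst (_≤ m) (+-comm 1 k) 1+k≤m)
          , (1≤k , <⇒≤ 1+k≤n) ) , subst New (sym (trans eq₁ e)) (proj₂ fr′)) , trans eq₁ e)))
      where
      ez : colour u z ≡ c (suc k , suc k)
      ez = below-least lst 1≤z (s≤s z≤n) (e₁ z k)
      eq₁ : colour 1 k ≡ c (suc k , k)
      eq₁ = cong (λ x → c (x , k)) (+-comm k 1)

    left : c (k , suc k) ≡ c (k , k)
    left =
      case sum-colours nr {z + suc u} {z} {k} {suc k} (≤-trans 1≤z (m≤m+n z (suc u))) 1≤z 1≤k (s≤s z≤n)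
             (proj₂ (proj₁ bound)) (proj₂ (proj₂ bound)) (e₃ z u k) (e₁ z k) of λ where
        (inj₁ e) → trans (sym e) ez
        (inj₂ (inj₁ e)) → ⊥-elim (new≢ fr 1≤k (<⇒≤ (≤-trans k<y (n≤1+n _))) (trans (sym ez) e))
        (inj₂ (inj₂ e)) → ⊥-elim (¬opp (k ,
          (( (≤-trans 1≤k (m≤m+n k 1) , subst (_≤ n) (+-comm 1 k) 1+k≤n)
          , (1≤k , <⇒≤ 1+k≤m) ) , subst New (sym (trans eq₁ e)) (proj₂ fr)) , trans eq₁ e))
      where
      ez : colour (suc u) z ≡ c (k , k)
      ez = below-least lst′ 1≤z 1≤k (+-comm z k)
      eq₁ : colourᵀ 1 k ≡ c (k , suc k)
      eq₁ = cong (λ x → c (k , x)) (+-comm k 1)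

  -- For y + u < K the point d_K - (y + u , y) lies on the opposite diagonal and shares the colour
  -- of d_K, which is incompatible with every position of a fresh point on that diagonal.
  representative-bound : ∀ {u y z K} → Fresh u y → Freshᵀ u z → colour u y ≢ colourᵀ u z →
    ¬ FreshColourᵀ (u + u) (colour u y) → ¬ FreshColourᵀ (u + u) (colourᵀ u z) →
    K ≤ p → (∀ {j} → 1 ≤ j → j < K → c (j , j) ≢ c (K , K)) → K ≤ y + u
  representative-bound {u} {y} {z} {K} fy fz y≢z ¬2y ¬2z K≤p first = ≮⇒≥ contra
    where
    1≤y = proj₁ (proj₂ (proj₁ fy))
    1≤z = proj₁ (proj₂ (proj₁ fz))
    zu≤n = proj₂ (proj₁ (proj₁ fz))
    z≤m = proj₂ (proj₂ (proj₁ fz))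
    z≤p = diag≤p z≤m (m+n≤o⇒m≤o z zu≤n)

    opposite : ∀ {a} → 1 ≤ a → y + u + a ≡ K → c (a , a + u) ≡ c (K , K)
    opposite {a} 1≤a e =
      case sum-colours nr {y + u} {y} {a} {a + u} (≤-trans 1≤y (m≤m+n y u)) 1≤y 1≤a
             (≤-trans 1≤a (m≤m+n a u)) (≤-trans K≤p p≤m) (≤-trans K≤p p≤n) e (trans (eq y u a) e) of λ where
        (inj₁ h) → ⊥-elim (y≢z (trans h (fresh-colourᵀ
            (( (≤-trans 1≤a (m≤m+n a u) , ≤-trans (subst (a + u ≤_) e (subst (a + u ≤_) (eq y u a) (m≤n+m (a + u) y))) (≤-trans K≤p p≤n))
             , (1≤a , ≤-trans (subst (a ≤_) e (m≤n+m a (y + u))) (≤-trans K≤p p≤m)))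
             , subst New h (proj₂ fy)) fz)))
        (inj₂ (inj₁ h)) → ⊥-elim (proj₂ fy 1≤K K≤p (sym h))
        (inj₂ (inj₂ h)) → h
      where
      eq : ∀ y u a → y + (a + u) ≡ y + u + a
      eq = solve-∀
      1≤K : 1 ≤ K
      1≤K = subst (1 ≤_) e (≤-trans 1≤a (m≤n+m a (y + u)))

    contra : ¬ (y + u < K)
    contra y+u<K with <⇒∃+ y+u<K
    ... | a , 1≤a , e = case <-cmp z a of λ where
        (tri< z<a _ _) → above z<a
        (tri≈ _ refl _) → proj₂ fz 1≤K K≤p (sym (opposite 1≤a e))
        (tri> _ _ a<z) → below a<z
      where
      1≤K : 1 ≤ K
      1≤K = ≤-trans (s≤s z≤n) y+u<K
      a+[y+u]≡K : a + (y + u) ≡ K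
      a+[y+u]≡K = trans (+-comm a (y + u)) e
      a≤K : a ≤ K
      a≤K = m+n≤o⇒m≤o a (≤-reflexive a+[y+u]≡K)
      a+u≤K : a + u ≤ K
      a+u≤K = ≤-trans (+-monoʳ-≤ a (m≤n+m u y)) (≤-reflexive a+[y+u]≡K)

      above : ¬ (z < a)
      above z<a with <⇒∃+ z<a
      ... | s , 1≤s , refl =
        case sum-colours nr 1≤z (≤-trans 1≤z (m≤m+n z u)) 1≤s 1≤s
               (≤-trans a≤K (≤-trans K≤p p≤m)) (≤-trans a+u≤K (≤-trans K≤p p≤n)) refl (eq z u s) of λ where
          (inj₁ h) → proj₂ fz 1≤s (≤-trans (<⇒≤ s<K) K≤p) (sym h)
          (inj₂ (inj₁ h)) → proj₂ fz 1≤K K≤p (sym (trans h (opposite 1≤a e)))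
          (inj₂ (inj₂ h)) → first 1≤s s<K (trans h (opposite 1≤a e))
        where
        eq : ∀ z u s → z + u + s ≡ z + s + u
        eq = solve-∀
        s<K : s < K
        s<K = ≤-trans (+-monoˡ-≤ s 1≤z) a≤K

      below : ¬ (a < z)
      below a<z with <⇒∃+ a<z
      ... | s , 1≤s , refl with K ≤? s
      ...   | no K≰s =
        case sum-colours nr 1≤a (≤-trans 1≤a (m≤m+n a u)) 1≤s 1≤s z≤m zu≤n refl (eq a u s) of λ where
          (inj₁ h) → first 1≤s (≰⇒> K≰s) (trans (sym h) (opposite 1≤a e))
          (inj₂ (inj₁ h)) → proj₂ fz 1≤K K≤p (trans (sym (opposite 1≤a e)) h)
          (inj₂ (inj₂ h)) → proj₂ fz 1≤s (≤-trans (m≤n+m s a) z≤p) h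
        where
        eq : ∀ a u s → a + u + s ≡ a + s + u
        eq = solve-∀
      -- For `s ≥ K` the minimality of `K` says nothing about `d_s`. Subtracting `(y + u , y)` from
      -- the fresh point `(z , z + u)` instead leaves a point at distance `u + u` on the opposite
      -- side, which is where the two exclusions at that distance enter.
      ...   | yes K≤s with <⇒∃+ (≤-trans y+u<K (≤-trans K≤s (m≤n+m s a)))
      ...     | d , 1≤d , e′ =
        case sum-colours nr {y + u} {y} {d} {d + (u + u)} (≤-trans 1≤y (m≤m+n y u)) 1≤y 1≤d 1≤d+2u
               z≤m zu≤n e′ eq′ of λ where
          (inj₁ h) → ¬2y (d , (inGrid , subst New h (proj₂ fy)) , sym h)
          (inj₂ (inj₁ h)) → y≢z h
          (inj₂ (inj₂ h)) → ¬2z (d , (inGrid , subst New (sym h) (proj₂ fz)) , h)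
        where
        1≤d+2u : 1 ≤ d + (u + u)
        1≤d+2u = ≤-trans 1≤d (m≤m+n d (u + u))
        eq : ∀ y u d → y + (d + (u + u)) ≡ y + u + d + u
        eq = solve-∀
        eq′ : y + (d + (u + u)) ≡ a + s + u
        eq′ = trans (eq y u d) (cong (_+ u) e′)
        inGrid : InGrid n m (d + (u + u) , d)
        inGrid = (1≤d+2u , m+n≤o⇒n≤o y (≤-trans (≤-reflexive eq′) zu≤n))
               , (1≤d , m+n≤o⇒n≤o (y + u) (≤-trans (≤-reflexive e′) z≤m))

  -- Descent along the representatives, away from the main diagonal.

  module Descent {A B : ℕ → Set} (status : ∀ u → A u ⊎ B u) (rep : ∀ {u} → A u → ∃ (Rep u))
                 {u₀ w k} (w<u₀ : w < u₀) (1≤k : 1 ≤ k)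
                 (opposite : ∀ {y} → Fresh u₀ y → ¬ FreshColourᵀ u₀ (colour u₀ y)) where

    -- If the first coordinate decreased, the difference of the two representatives would be a grid
    -- point at distance `g = v - u` on the opposite side. Since `g ≤ w + 1 ≤ u₀ ≤ u`, this is too
    -- near the main diagonal for it to carry the colour of either representative.
    slow-descent : ∀ {u y v z} → u₀ ≤ u → u < v → v ≤ u + suc w → Rep u y → Rep v z → z < y →
      y + u ≤ z + v
    slow-descent {u} {y} {v} {z} u₀≤u u<v v≤ (lu@(fu , _) , seenᵤ) ((fv , _) , seenᵥ) z<y =
      ≮⇒≥ contra
      where
      contra : ¬ (z + v < y + u)
      contra z+v<y+u with <⇒∃+ z+v<y+u | <⇒∃+ u<v
      ... | e , 1≤e , h | g , 1≤g , refl =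
        case sum-colours nr {z + (u + g)} {z} {e} {e + g} (≤-trans 1≤z (m≤m+n z _)) 1≤z 1≤e 1≤e+g
               (proj₂ (proj₁ (proj₁ fu))) (proj₂ (proj₂ (proj₁ fu))) h h′ of λ where
          (inj₁ q) → seenᵥ (m<n+m g 1≤u) (inj₂ (e , (inGrid , subst New q (proj₂ fv)) , sym q))
          (inj₂ (inj₁ q)) → seenᵥ (m<m+n u 1≤g) (inj₁ (_ , fu , sym q))
          (inj₂ (inj₂ q)) → excluded (e , (inGrid , subst New (sym q) (proj₂ fu)) , q)
        where
        1≤z = proj₁ (proj₂ (proj₁ fv))
        1≤u : 1 ≤ u
        1≤u = ≤-trans (≤-trans (s≤s z≤n) w<u₀) u₀≤u
        1≤e+g : 1 ≤ e + g
        1≤e+g = ≤-trans 1≤e (m≤m+n e g)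
        eq : ∀ z u g e → z + (u + g) + e ≡ z + (e + g) + u
        eq = solve-∀
        h′ : z + (e + g) ≡ y
        h′ = +-cancelʳ-≡ u _ _ (trans (sym (eq z u g e)) h)
        inGrid : InGrid n m (e + g , e)
        inGrid = (1≤e+g , m+n≤o⇒n≤o z (≤-trans (≤-reflexive h′) (proj₂ (proj₂ (proj₁ fu)))))
               , (1≤e , m+n≤o⇒n≤o (z + (u + g)) (≤-trans (≤-reflexive h) (proj₂ (proj₁ (proj₁ fu)))))
        g≤1+w : g ≤ suc w
        g≤1+w = +-cancelˡ-≤ u g (suc w) v≤
        excluded : ¬ FreshColourᵀ g (colour u y)
        excluded fc with m≤n⇒m<n∨m≡n (≤-trans g≤1+w (≤-trans w<u₀ u₀≤u))
        ... | inj₁ g<u = seenᵤ g<u (inj₂ fc)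
        -- Here `g = u` forces `u = u₀ = w + 1`, the one case left to the hypothesis on the starting
        -- diagonal.
        ... | inj₂ refl with ≤-antisym u₀≤u (≤-trans g≤1+w w<u₀)
        ...   | refl = opposite fu fc

    Goal : Set
    Goal = c (suc k , k) ≡ c (suc k , suc k) × c (k , suc k) ≡ c (k , k)

    mutual
      -- Each missed diagonal lets the height y of the representatives drop by at most 2.
      descend : ∀ d {u y b} → u₀ ≤ u → Rep u y → suc u + d ≡ m → ∑ (misses status) (suc u) d ≤ b →
        b ≤ w → suc (suc k) + (b + b) ≤ y → Goal
      descend zero {u} {y} u₀≤u ((((( _ , yu≤) , _) , _) , _) , _) refl _ _ high =
        ⊥-elim (<⇒≱ (≤-trans (s≤s (s≤s z≤n)) high)
          (+-cancelʳ-≤ u y 1 (≤-trans yu≤ (≤-reflexive (+-identityʳ (suc u))))))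
      descend (suc d) {u} {y} {b} u₀≤u r e few b≤w high with status (suc u) | few
      ... | inj₁ a | few′ with rep a
      ...   | z , r′ with y ≤? z
      ...     | yes y≤z = descend d (m≤n⇒m≤1+n u₀≤u) r′ (trans (sym (+-suc (suc u) d)) e) few′ b≤w (≤-trans high y≤z)
      -- Between neighbouring diagonals a drop is by exactly one, the configuration of
      -- `descent-colours`; the summand `k + 2` in `high` keeps the lower representative above `k`.
      ...     | no y≰z with ≤-antisym (≰⇒> y≰z) (+-cancelʳ-≤ u y (suc z) (≤-trans
                  (slow-descent u₀≤u (n<1+n u) (≤-trans (≤-reflexive (+-comm 1 u)) (+-monoʳ-≤ u (s≤s z≤n)))
                    r r′ (≰⇒> y≰z)) (≤-reflexive (+-suc z u))))
      ...       | refl = descent-colours 1≤u r r′ ¬opp 1≤k (≤-pred (≤-trans (m≤m+n (suc (suc k)) (b + b)) high))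
        where
        1≤u : 1 ≤ u
        1≤u = ≤-trans (≤-trans (s≤s z≤n) w<u₀) u₀≤u
        ¬opp : ¬ FreshColourᵀ 1 (colour u (suc z))
        ¬opp fc with m≤n⇒m<n∨m≡n 1≤u
        ... | inj₁ 1<u = proj₂ r 1<u (inj₂ fc)
        ... | inj₂ refl with ≤-antisym u₀≤u (≤-trans (s≤s z≤n) w<u₀)
        ...   | refl = opposite (proj₁ (proj₁ r)) fc
      -- Spending one miss frees two units of height, exactly the gap from `u` to the next candidate
      -- `u + 2`.
      descend (suc d) {u} {y} {suc b} u₀≤u r e few b≤w high | inj₂ _ | s≤s few′ =
        skip d u₀≤u r (m<n+m u (s≤s z≤n)) (trans (sym (+-suc (suc u) d)) e) few′
          (≤-trans (≤-reflexive (e₁ u b)) (+-monoʳ-≤ u (s≤s b≤w)))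
          (≤-trans (≤-reflexive (e₂ u b k)) (+-monoˡ-≤ u high))
        where
        e₁ : ∀ u b → suc (suc u) + b ≡ u + suc (suc b)
        e₁ = solve-∀
        e₂ : ∀ u b k → suc (suc k) + (b + b) + suc (suc u) ≡ suc (suc k) + (suc b + suc b) + u
        e₂ = solve-∀

      -- `u` is the last diagonal with a representative and `v` the next candidate. `near` keeps the
      -- gap within reach of `slow-descent`; `high` is stated through the first coordinate `y + u`,
      -- the quantity that does not decrease across the gap.
      skip : ∀ d {u y v b} → u₀ ≤ u → Rep u y → u < v → v + d ≡ m → ∑ (misses status) v d ≤ b →
        v + b ≤ u + suc w → suc (suc k) + (b + b) + v ≤ y + u → Goal
      skip zero {u} {y} {v} u₀≤u ((((( _ , yu≤) , _) , _) , _) , _) _ refl _ _ high =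
        ⊥-elim (<⇒≱ (≤-trans (s≤s (m≤n+m v _)) high) (≤-trans yu≤ (≤-reflexive (+-identityʳ v))))
      skip (suc d) {u} {y} {v} {b} u₀≤u r u<v e few near high with status v | few
      ... | inj₁ a | few′ with rep a
      ...   | z , r′ = descend d (≤-trans u₀≤u (<⇒≤ u<v)) r′ (trans (sym (+-suc v d)) e) few′
                b≤w (+-cancelʳ-≤ v _ z (≤-trans high y+u≤z+v))
        where
        b≤w : b ≤ w
        b≤w = ≤-pred (+-cancelˡ-≤ u _ _ (≤-trans (≤-trans (≤-reflexive (+-suc u b)) (+-monoˡ-≤ b u<v)) near))
        y+u≤z+v : y + u ≤ z + v
        y+u≤z+v with y ≤? z
        ... | yes y≤z = +-mono-≤ y≤z (<⇒≤ u<v)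
        ... | no y≰z = slow-descent u₀≤u u<v (≤-trans (m≤m+n v b) near) r r′ (≰⇒> y≰z)
      skip (suc d) {u} {y} {v} {suc b} u₀≤u r u<v e few near high | inj₂ _ | s≤s few′ =
        skip d u₀≤u r (m<n⇒m<1+n u<v) (trans (sym (+-suc v d)) e) few′
          (≤-trans (≤-reflexive (sym (+-suc v b))) near)
          (≤-trans (≤-trans (n≤1+n _) (≤-reflexive (e₁ v b k))) high)
        where
        e₁ : ∀ v b k → suc (suc (suc k) + (b + b) + suc v) ≡ suc (suc k) + (suc b + suc b) + v
        e₁ = solve-∀

-- First occurrences of colours on the main diagonal.

module MainDiagonal (m n : ℕ) (m≤n : m ≤ n) (c : Coloring) (nr : NoRainbow m n c) where

  First : ℕ → Set
  First k = ∀ {j} → 1 ≤ j → j < k → c (j , j) ≢ c (k , k)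

  Recurring : ℕ → Set
  Recurring k = ∃ λ j → 1 ≤ j × j < k × c (j , j) ≡ c (k , k)

  abstract
    first? : ∀ k → First k ⊎ Recurring k
    first? k with anyUpTo? (λ j → (1 ≤? j) ×-dec (c (j , j) ≟ c (k , k))) k
    ... | yes (j , j<k , 1≤j , e) = inj₂ (j , 1≤j , j<k , e)
    ... | no none = inj₁ λ 1≤j j<k e → none (_ , j<k , 1≤j , e)

  -- If `j = b - a` were less than `a`, then `d_a + d_j = d_b` would make two of the three colours
  -- equal, and each such equality gives `d_a` or `d_b` an earlier occurrence.
  first-doubles : ∀ {a b} → First a → First b → 1 ≤ a → a < b → b ≤ m → 2 * a ≤ b
  first-doubles {a} fa fb 1≤a a<b b≤m with <⇒∃+ a<b
  ... | j , 1≤j , refl with a ≤? j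
  ...   | yes a≤j = +-monoʳ-≤ a (≤-trans (≤-reflexive (+-identityʳ a)) a≤j)
  ...   | no a≰j =
    case sum-colours nr 1≤a 1≤a 1≤j 1≤j b≤m (≤-trans b≤m m≤n) refl refl of λ where
      (inj₁ e) → ⊥-elim (fa 1≤j (≰⇒> a≰j) (sym e))
      (inj₂ (inj₁ e)) → ⊥-elim (fb 1≤a a<b e)
      (inj₂ (inj₂ e)) → ⊥-elim (fb 1≤j (m<n+m j 1≤a) e)

  Spread : ℕ → ℕ → Set
  Spread k e = ∃ λ K → First K × K ≤ m × 2 ^ e * k ≤ K

  spread : ∀ d {v k e K} → First K → 1 ≤ K → K < v → K ≤ m → v + d ≡ suc m → 2 ^ e * k ≤ K →
    Spread k (e + ∑ (hits first?) v d)
  spread zero {e = e} {K} fK _ _ K≤m _ far rewrite +-identityʳ e = K , fK , K≤m , far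
  spread (suc d) {v} {k} {e} {K} fK 1≤K K<v K≤m h far with first? v
  ... | inj₂ _ = spread d {e = e} fK 1≤K (m<n⇒m<1+n K<v) K≤m (trans (sym (+-suc v d)) h) far
  ... | inj₁ fv rewrite +-suc e (∑ (hits first?) (suc v) d) =
    spread d {e = suc e} fv (≤-trans 1≤K (<⇒≤ K<v)) (n<1+n v) v≤m (trans (sym (+-suc v d)) h)
      (≤-trans (≤-trans (≤-reflexive (*-assoc 2 (2 ^ e) k)) (*-monoʳ-≤ 2 far))
        (first-doubles fK fv 1≤K K<v v≤m))
    where
    v≤m : v ≤ m
    v≤m = ≤-pred (≤-trans (m≤m+n (suc v) d) (≤-reflexive (trans (sym (+-suc v d)) h)))

  -- The first hit becomes `k`; each of the `e` later hits contributes one doubling.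
  second-spread : ∀ d {v e} → 2 ≤ v → v + d ≡ suc m → ∑ (hits first?) v d ≡ suc e →
    ∃ λ k → 2 ≤ k × First k × Spread k e
  second-spread (suc d) {v} 2≤v h count with first? v | count
  ... | inj₂ _ | count′ = second-spread d (m≤n⇒m≤1+n 2≤v) (trans (sym (+-suc v d)) h) count′
  ... | inj₁ fv | refl = v , 2≤v , fv ,
    spread d {e = 0} fv (<⇒≤ 2≤v) (n<1+n v)
      (≤-pred (≤-trans (m≤m+n (suc v) d) (≤-reflexive (trans (sym (+-suc v d)) h))))
      (trans (sym (+-suc v d)) h) (≤-reflexive (+-identityʳ v))

-- Counting the colours of the whole grid.

module Exact (m n : ℕ) (1≤m : 1 ≤ m) (m≤n : m ≤ n) (c : Coloring) (nr : NoRainbow m n c) where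

  open MainDiagonal m n m≤n c nr
  module L = Half m n m ≤-refl m≤n (λ y≤m _ → y≤m) c nr
  module U = Half n m m m≤n ≤-refl (λ _ y≤m → y≤m) (c ᵀ) (noRainbowᵀ nr)

  -- A color occurring on both D_{m-u} and D_{m+u} is counted on the former.
  UpperRep UpperRepeated : ℕ → Set
  UpperRep u = ∃ λ y → U.Rep u y × ¬ L.FreshColour u (U.colour u y)
  UpperRepeated u = ∀ {y} → U.Fresh u y →
    (∃ λ v → v < u × U.Seen v (U.colour u y)) ⊎ L.FreshColour u (U.colour u y)

  abstract
    upperStatus : ∀ u → UpperRep u ⊎ UpperRepeated u
    upperStatus u with U.status u
    ... | inj₂ repeated = inj₂ (inj₁ ∘ repeated)
    ... | inj₁ (y , r) with L.freshColour? u (U.colour u y)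
    ...   | yes (z , fz , e) = inj₂ λ f → inj₂ (z , fz , trans e (U.fresh-colour (proj₁ (proj₁ r)) f))
    ...   | no ¬fc = inj₁ (y , r , ¬fc)

  lowerMisses upperMisses : ℕ → ℕ
  lowerMisses = misses L.status
  upperMisses = misses upperStatus

  mainColours lowerColours upperColours allColours : List ℕ
  mainColours = collect first? (λ {k} _ → c (k , k)) 1 m
  lowerColours = collect L.status (λ {u} (y , _) → L.colour u y) 1 (m ∸ 1)
  upperColours = collect upperStatus (λ {u} (y , _) → U.colour u y) 1 (n ∸ 1)
  allColours = mainColours ++ (lowerColours ++ upperColours)

  main-∈ : ∀ k → 1 ≤ k → k ≤ m → c (k , k) ∈ mainColours
  main-∈ = <-rec _ λ k rec 1≤k k≤m → step k rec 1≤k k≤m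
    where
    step : ∀ k → (∀ {j} → j < k → 1 ≤ j → j ≤ m → c (j , j) ∈ mainColours) →
      1 ≤ k → k ≤ m → c (k , k) ∈ mainColours
    step k rec 1≤k k≤m with first? k in eq
    ... | inj₁ _ = ∈-collect first? _ m 1≤k (s≤s k≤m) eq
    ... | inj₂ (j , 1≤j , j<k , e) = subst (_∈ mainColours) e (rec j<k 1≤j (≤-trans (<⇒≤ j<k) k≤m))

  Covered : ℕ → Set
  Covered u = (∀ {y} → L.Fresh u y → L.colour u y ∈ allColours) ×
              (∀ {y} → U.Fresh u y → U.colour u y ∈ allColours)

  -- Induction on the distance, for both sides at once because a repeated colour may have been seen
  -- earlier on either side. The upper side may also fall back on the lower one at the same
  -- distance.
  covered : ∀ u → Covered u
  covered = <-rec _ step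
    where
    offset< : ∀ {u y s} → 1 ≤ y → y + u ≤ s → u < 1 + (s ∸ 1)
    offset< {u} {y} {zero} 1≤y y+u≤s = ⊥-elim (<⇒≱ (≤-trans 1≤y (m≤m+n y u)) y+u≤s)
    offset< {u} {y} {suc s} 1≤y y+u≤s = ≤-trans (+-monoˡ-≤ u 1≤y) y+u≤s

    step : ∀ u → (∀ {v} → v < u → Covered v) → Covered u
    -- Distance 0 is the main diagonal itself, where nothing is fresh.
    step zero _ = (λ { {y} (g , new) → ⊥-elim (new (proj₁ (proj₂ g)) (≤-trans (m≤m+n y 0) (proj₂ (proj₁ g)))
                         (cong (λ x → c (x , y)) (sym (+-identityʳ y)))) })
                , (λ { {y} (g , new) → ⊥-elim (new (proj₁ (proj₂ g)) (proj₂ (proj₂ g))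
                         (cong (λ x → c (y , x)) (sym (+-identityʳ y)))) })
    step u@(suc _) rec = lower , upper
      where
      seen-∈ : ∀ {v x} → v < u → L.Seen v x → x ∈ allColours
      seen-∈ v<u (inj₁ (_ , f , refl)) = proj₁ (rec v<u) f
      seen-∈ v<u (inj₂ (_ , f , refl)) = proj₂ (rec v<u) f

      lower : ∀ {y} → L.Fresh u y → L.colour u y ∈ allColours
      lower {y} f@(((_ , y+u≤m) , (1≤y , _)) , _) with L.status u in eq
      ... | inj₁ (z , r) = ∈-++⁺ʳ mainColours (∈-++⁺ˡ (subst (_∈ lowerColours)
            (L.fresh-colour (proj₁ (proj₁ r)) f)
            (∈-collect L.status _ (m ∸ 1) (s≤s z≤n) (offset< 1≤y y+u≤m) eq)))
      ... | inj₂ repeated with repeated f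
      ...   | v , v<u , seen = seen-∈ v<u seen

      upper : ∀ {y} → U.Fresh u y → U.colour u y ∈ allColours
      upper {y} f@(((_ , y+u≤n) , (1≤y , _)) , _) with upperStatus u in eq
      ... | inj₁ (z , r , _) = ∈-++⁺ʳ mainColours (∈-++⁺ʳ lowerColours (subst (_∈ upperColours)
            (U.fresh-colour (proj₁ (proj₁ r)) f)
            (∈-collect upperStatus _ (n ∸ 1) (s≤s z≤n) (offset< 1≤y y+u≤n) eq)))
      ... | inj₂ repeated with repeated f
      ...   | inj₁ (v , v<u , inj₁ seen) = seen-∈ v<u (inj₂ seen)
      ...   | inj₁ (v , v<u , inj₂ seen) = seen-∈ v<u (inj₁ seen)
      ...   | inj₂ (z , fz , e) = subst (_∈ allColours) e (lower fz)

  grid-∈ : ∀ x → InGrid m n x → c x ∈ allColours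
  grid-∈ (i , j) g@((1≤i , i≤m) , (1≤j , j≤n)) with L.onMain? (c (i , j))
  ... | inj₁ (k , s≤s k≤m , 1≤k , e) = subst (_∈ allColours) e (∈-++⁺ˡ (main-∈ k 1≤k k≤m))
  ... | inj₂ new with <-cmp i j
  ...   | tri≈ _ refl _ = ⊥-elim (new 1≤i i≤m refl)
  ...   | tri< i<j _ _ with <⇒∃+ i<j
  ...     | u , _ , refl = proj₂ (covered u) (((1≤j , j≤n) , (1≤i , i≤m)) , new)
  grid-∈ (i , j) g@((1≤i , i≤m) , (1≤j , j≤n)) | inj₂ new | tri> _ _ j<i with <⇒∃+ j<i
  ...     | u , _ , refl = proj₁ (covered u) (g , new)

  totalMisses : ℕ
  totalMisses = ∑ lowerMisses 1 (m ∸ 1) + ∑ upperMisses 1 (n ∸ 1)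

  length-allColours : length allColours + totalMisses ≡ ∑ (hits first?) 1 m + ((m ∸ 1) + (n ∸ 1))
  length-allColours
    rewrite length-++ mainColours {lowerColours ++ upperColours} | length-++ lowerColours {upperColours}
          | length-collect first? (λ {k} _ → c (k , k)) 1 m
          | length-collect L.status (λ {u} (y , _) → L.colour u y) 1 (m ∸ 1)
          | length-collect upperStatus (λ {u} (y , _) → U.colour u y) 1 (n ∸ 1) =
    trans (eq (∑ (hits first?) 1 m) (∑ (hits L.status) 1 (m ∸ 1)) (∑ (hits upperStatus) 1 (n ∸ 1)) _ _)
      (cong (∑ (hits first?) 1 m +_)
        (cong₂ _+_ (hits+misses L.status 1 (m ∸ 1)) (hits+misses upperStatus 1 (n ∸ 1))))
    where
    eq : ∀ a b d x y → a + (b + d) + (x + y) ≡ a + ((b + x) + (d + y))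
    eq = solve-∀

  -- Off the main diagonal there are `(m - 1) + (n - 1)` diagonals with at most one new colour each,
  -- and `m + n + 1` exceeds their number by 3.
  misses-bound : (∀ k → 1 ≤ k → k ≤ m + n + 1 → ∃ λ x → InGrid m n x × c x ≡ k) →
    3 + totalMisses ≤ ∑ (hits first?) 1 m
  misses-bound onto = +-cancelʳ-≤ ((m ∸ 1) + (n ∸ 1)) _ _ (begin
    3 + totalMisses + ((m ∸ 1) + (n ∸ 1))               ≡⟨ eq totalMisses (m ∸ 1) (n ∸ 1) ⟩
    suc (m ∸ 1) + suc (n ∸ 1) + 1 + totalMisses         ≡⟨ cong₂ (λ x y → x + y + 1 + totalMisses)
                                                            (m+[n∸m]≡n 1≤m) (m+[n∸m]≡n (≤-trans 1≤m m≤n)) ⟩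
    m + n + 1 + totalMisses                             ≤⟨ +-monoˡ-≤ totalMisses (covering⇒≤length _ allColours cover) ⟩
    length allColours + totalMisses                     ≡⟨ length-allColours ⟩
    ∑ (hits first?) 1 m + ((m ∸ 1) + (n ∸ 1))           ∎)
    where
    open ≤-Reasoning
    eq : ∀ t a b → 3 + t + (a + b) ≡ suc a + suc b + 1 + t
    eq = solve-∀
    cover : ∀ k → 1 ≤ k → k ≤ m + n + 1 → k ∈ allColours
    cover k 1≤k k≤ with onto k 1≤k k≤
    ... | x , g , refl = grid-∈ x g


  1+[m∸1]≡m : suc (m ∸ 1) ≡ m
  1+[m∸1]≡m = m+[n∸m]≡n 1≤m

  1+[n∸1]≡n : suc (n ∸ 1) ≡ n
  1+[n∸1]≡n = m+[n∸m]≡n (≤-trans 1≤m m≤n)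

  hits-first : ∑ (hits first?) 1 m ≡ suc (∑ (hits first?) 2 (m ∸ 1))
  hits-first = trans (cong (∑ (hits first?) 1) (sym 1+[m∸1]≡m)) (cong (_+ ∑ (hits first?) 2 (m ∸ 1)) hit)
    where
    hit : hits first? 1 ≡ 1
    hit with first? 1
    ... | inj₁ _ = refl
    ... | inj₂ (_ , 1≤j , j<1 , _) = ⊥-elim (<⇒≱ j<1 1≤j)

  -- Diagonals contributing on both sides, and the contradiction.

  Mirrored : ℕ → Set
  Mirrored i = ∃ (L.Rep i) × UpperRep i

  ∑bothMisses≤ : ∀ {v d} → 1 ≤ v → v + d ≤ m → ∑ (bothMisses L.status upperStatus) v d ≤ totalMisses
  ∑bothMisses≤ {v} {d} 1≤v v+d≤m = begin
    ∑ (bothMisses L.status upperStatus) v d            ≡⟨ ∑-+ lowerMisses upperMisses v d ⟩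
    ∑ lowerMisses v d + ∑ upperMisses v d              ≤⟨ +-mono-≤
      (∑-⊆ lowerMisses 1≤v (≤-trans v+d≤m (≤-reflexive (sym 1+[m∸1]≡m))))
      (∑-⊆ upperMisses 1≤v (≤-trans (≤-trans v+d≤m m≤n) (≤-reflexive (sym 1+[n∸1]≡n)))) ⟩
    totalMisses                                        ∎
    where open ≤-Reasoning

  -- The intervals from `w + 1` to `2w + 1` and from `2w + 2` to `4w + 3` are disjoint, so at most
  -- `w` misses face `w + 1` candidates. The double `i + i` is wanted because a representative there
  -- keeps the colours seen at `i` away, as `representative-bound` requires.
  mirrored : ∀ {w} → totalMisses ≤ w → 4 * suc w ≤ m →
    ∃ λ i → suc w ≤ i × i < suc w + suc w × Mirrored i × Mirrored (i + i)
  mirrored {w} few 4+4w≤m with doubleHit L.status upperStatus (suc w) (suc w)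
  ... | inj₁ found = found
  ... | inj₂ many = ⊥-elim (<⇒≱ (≤-trans many (begin
    ∑ β (suc w) (suc w) + ∑ β (suc w + suc w) (suc w + suc w)
      ≡⟨ ∑-++ β (suc w) (suc w) (suc w + suc w) ⟨
    ∑ β (suc w) (suc w + (suc w + suc w))
      ≤⟨ ∑bothMisses≤ (s≤s z≤n) (≤-trans (≤-reflexive (eq (suc w))) 4+4w≤m) ⟩
    totalMisses  ∎)) few)
    where
    open ≤-Reasoning
    β = bothMisses L.status upperStatus
    eq : ∀ x → x + (x + (x + x)) ≡ 4 * x
    eq = solve-∀

  contradictory : ∀ {w k K} → totalMisses ≤ w → 1 ≤ k → First (suc k) → First K → K ≤ m →
    2 ^ suc w * suc k ≤ K → ⊥
  contradictory {w} {k} {K} few 1≤k first-k first-K K≤m far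
    with mirrored few (≤-trans 4+4w≤ (≤-trans far K≤m))
    where
    4+4w≤ : 4 * suc w ≤ 2 ^ suc w * suc k
    4+4w≤ = ≤-trans (≤-reflexive (eq w)) (*-mono-≤ (*-monoʳ-≤ 2 (1+n≤2^n w)) (s≤s 1≤k))
      where
      eq : ∀ w → 4 * suc w ≡ 2 * suc w * 2
      eq = solve-∀
  ... | u , w<u , u< , ((y , r) , (z , s , ¬fc)) , ((y₂ , r₂) , (z₂ , s₂ , _)) =
    first-k 1≤k (n<1+n k) (trans (sym (proj₂ lower)) (proj₁ upper))
    where
    fy : L.Fresh u y
    fy = proj₁ (proj₁ r)
    fz : U.Fresh u z
    fz = proj₁ (proj₁ s)

    y≢z : L.colour u y ≢ U.colour u z
    y≢z e = ¬fc (y , fy , e)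

    u<u+u : u < u + u
    u<u+u = m<m+n u (≤-trans (s≤s z≤n) w<u)

    -- `representative-bound` controls only the first coordinate, so `u ≤ 2w + 1` has to be
    -- subtracted. This is affordable because `K ≥ 2(w + 1)(k + 1)` and `k + 1 ≥ 2`.
    high : ∀ {x} → K ≤ x + u → suc (suc k) + (w + w) ≤ x
    high {x} K≤x+u = +-cancelʳ-≤ u _ x (begin
      suc (suc k) + (w + w) + u            ≤⟨ +-monoʳ-≤ _ (≤-pred u<) ⟩
      suc (suc k) + (w + w) + (w + suc w)  ≡⟨ e₁ w k ⟩
      suc k + (w + suc w) * 2              ≤⟨ +-monoʳ-≤ (suc k) (*-monoʳ-≤ (w + suc w) (s≤s 1≤k)) ⟩
      suc k + (w + suc w) * suc k          ≡⟨ e₂ w k ⟩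
      2 * suc w * suc k                    ≤⟨ *-monoˡ-≤ (suc k) (*-monoʳ-≤ 2 (1+n≤2^n w)) ⟩
      2 ^ suc w * suc k                    ≤⟨ far ⟩
      K                                    ≤⟨ K≤x+u ⟩
      x + u                                ∎)
      where
      open ≤-Reasoning
      e₁ : ∀ w k → suc (suc k) + (w + w) + (w + suc w) ≡ suc k + (w + suc w) * 2
      e₁ = solve-∀
      e₂ : ∀ w k → suc k + (w + suc w) * suc k ≡ 2 * suc w * suc k
      e₂ = solve-∀

    u<m : u < m
    u<m = ≤-trans (+-monoˡ-≤ u (proj₁ (proj₂ (proj₁ fy)))) (proj₂ (proj₁ (proj₁ fy)))

    lower : c (suc k , k) ≡ c (suc k , suc k) × c (k , suc k) ≡ c (k , k)
    lower = L.Descent.descend L.status (λ a → a) w<u 1≤k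
      (λ { f (x , fx , e) → y≢z (trans (L.fresh-colour fy f) (trans (sym e) (U.fresh-colour fx fz))) })
      (m ∸ suc u) ≤-refl r (m+[n∸m]≡n u<m)
      (≤-trans (∑-⊆ lowerMisses {w = suc u} {e = m ∸ suc u} (s≤s z≤n) (≤-reflexive (trans (m+[n∸m]≡n u<m) (sym 1+[m∸1]≡m))))
        (≤-trans (m≤m+n _ _) few))
      ≤-refl
      (high (L.representative-bound fy fz y≢z
        (U.rep-excludes s₂ u<u+u (inj₂ (y , fy , refl))) (U.rep-excludes s₂ u<u+u (inj₁ (z , fz , refl)))
        K≤m first-K))

    u<n : u < n
    u<n = ≤-trans u<m m≤n

    upper : c (k , suc k) ≡ c (suc k , suc k) × c (suc k , k) ≡ c (k , k)
    upper = U.Descent.descend upperStatus (λ (x , h , _) → x , h) w<u 1≤k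
      (λ { f (x , fx , e) → y≢z (trans (L.fresh-colour fy fx) (trans e (U.fresh-colour f fz))) })
      (n ∸ suc u) ≤-refl s (m+[n∸m]≡n u<n)
      (≤-trans (∑-⊆ upperMisses {w = suc u} {e = n ∸ suc u} (s≤s z≤n) (≤-reflexive (trans (m+[n∸m]≡n u<n) (sym 1+[n∸1]≡n))))
        (≤-trans (m≤n+m _ _) few))
      ≤-refl
      (high (U.representative-bound fz fy (y≢z ∘ sym)
        (L.rep-excludes r₂ u<u+u (inj₂ (z , fz , refl))) (L.rep-excludes r₂ u<u+u (inj₁ (y , fy , refl)))
        K≤m first-K))

  not-onto : ¬ (∀ k → 1 ≤ k → k ≤ m + n + 1 → ∃ λ x → InGrid m n x × c x ≡ k)
  not-onto onto with m≤n⇒∃[o]m+o≡n (misses-bound onto)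
  -- Of the `3 + w` first occurrences, with the slack `e` absorbed into `w`, one is `d_1` and one is
  -- `d_(k+1)`; the other `w + 1` give the exponent.
  ... | e , h with second-spread (m ∸ 1) ≤-refl (cong suc 1+[m∸1]≡m)
                     (suc-injective (trans (sym hits-first) (sym h)))
  ...   | suc k , s≤s 1≤k , first-k , K , first-K , K≤m , far =
    contradictory (m≤m+n totalMisses e) 1≤k first-k first-K K≤m far

theorem4p9 : (m n : ℕ) → 3 ≤ m → m ≤ n → (c : Coloring) →
    IsExactColoring m n (m + n + 1) c → NoRainbow m n c →
    (a b t : ℕ) (α β δ : Point) →
    Jump m n a b α β → InDiag m n t δ → α ⊕ δ ≡ β →
    ColorOnDiag m n c m (c α) ⊎ ColorOnDiag m n c m (c β) ⊎ c α ≡ c β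
theorem4p9 m n 3≤m m≤n c exact nr _ _ _ _ _ _ _ _ _ =
  ⊥-elim (Exact.not-onto m n (≤-trans (s≤s z≤n) 3≤m) m≤n c nr (proj₂ exact))
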